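{- Let $p$ be an atom. For each $k\in\{1,\dots,14\}$, the following first-order condition number $k$ and signed formula number $k$ are such that, with respect to the class of all frames, the signed formula is a positive definition of the class of all frames where the condition holds (i.e. for every frame $(W,\leq,R)$, the signed formula is valid in $(W,\leq,R)$ if and only if the condition holds in $(W,\leq,R)$): 1. $\forall s\,\exists t\; s({\geq}\circ R)t$ : $(+,\lozenge\top)$. 2. $\forall s\,\exists t\; s({\leq}\circ R)t$ : $(-,\square\bot)$. 3. $\forall s\; s({\geq}\circ R\circ{\geq})s$ : $(+,p\rightharpoonup\lozenge p)$. 4. $\forall s\; s({\leq}\circ R\circ{\leq})s$ : $(-,p\leftharpoondown\square p)$. 5. $\forall s\; s(R\circ{\geq})s$ : $(+,p\rightharpoonup⧫ p)$. 6. $\forall s\; s(R\circ{\leq})s$ : $(-,p\leftharpoondown\blacksquare p)$. 7. $\forall s,t\;(sRt\Rightarrow t({\geq}\circ R\circ{\geq})s)$ : $(+,p\rightharpoonup\square\lozenge p)$. 8. $\forall s,t\;(sRt\Rightarrow t({\leq}\circ R\circ{\leq})s)$ : $(-,p\leftharpoondown\lozenge\square p)$. 9. $\forall s,t\;(s(R\circ{\leq})t\Rightarrow t(R\circ{\geq})s)$ : $(+,p\rightharpoonup\square⧫ p)$. 10. $\forall s,t\;(s(R\circ{\geq})t\Rightarrow t(R\circ{\leq})s)$ : $(-,p\leftharpoondown\lozenge\blacksquare p)$. 11. $\forall s\,\exists t\,(t\leq s\ \&\ \forall u\,(tRu\Rightarrow u({\geq}\circ R\circ{\geq})s))$ : $(+,p\rightharpoonup\blacksquare\lozenge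 p)$. 12. $\forall s\,\exists t\,(t\geq s\ \&\ \forall u\,(tRu\Rightarrow u({\leq}\circ R\circ{\leq})s))$ : $(-,p\leftharpoondown⧫\square p)$. 13. $\forall s\,\exists t\,(t\leq s\ \&\ \forall u\,(t(R\circ{\leq})u\Rightarrow u(R\circ{\geq})s))$ : $(+,p\rightharpoonup\blacksquare⧫ p)$. 14. $\forall s\,\exists t\,(t\geq s\ \&\ \forall u\,(t(R\circ{\geq})u\Rightarrow u(R\circ{\leq})s))$ : $(-,p\leftharpoondown⧫\blacksquare p)$.
   Context: Syntax. $\mathbf{At}=\{p_i : i\in\mathbb{N}\}$ is a countable set of atoms (enumerated without repetition). The set $\mathbf{Fo}$ of formulas is generated by $A ::= p \mid (A\rightharpoonup A)\mid (A\leftharpoondown A)\mid \top\mid\bot\mid (A\vee A)\mid (A\wedge A)\mid \lozenge A\mid\square A\mid⧫ A\mid\blacksquare A$, with $p\in\mathbf{At}$. A signed formula is a pair $(\alpha,A)$ with $\alpha\in\{+,-\}$ and $A\in\mathbf{Fo}$. Semantics. A frame is a triple $(W,\leq,R)$ where $W\neq\emptyset$, $\leq$ is a preorder on $W$ and $R$ is a binary relation on $W$; $\geq$ is the converse of $\leq$. A valuation is a function $V:\mathbf{At}\to\wp(W)$ such that each $V(p)$ is $\leq$-closed (if $s\in V(p)$ and $s\leq t$ then $t\in V(p)$). A model based on $(W,\leq,R)$ is $(W,\leq,R,V)$ with $V$ a valuation. Satisfaction at $s\in W$: $s\models p$ iff $s\in V(p)$; $s\models\top$; $s\not\models\bot$;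 $\vee,\wedge$ as usual pointwise; - $s\models A\rightharpoonup B$ iff for all $t\geq s$, $t\not\models A$ or $t\models B$; - $s\models A\leftharpoondown B$ iff there is $t\leq s$ with $t\not\models A$ and $t\models B$; - $s\models\lozenge A$ iff there are $t\leq s$ and $u$ with $tRu$ and $u\models A$; - $s\models\square A$ iff for all $t\geq s$ and all $u$, $tRu$ implies $u\models A$; - $s\models⧫ A$ iff for all $t\geq s$ there is $u$ with $tRu$ and $u\models A$; - $s\models\blacksquare A$ iff there is $t\leq s$ such that for all $u$, $tRu$ implies $u\models A$. Further, $s\models(+,A)$ iff $s\models A$, and $s\models(-,A)$ iff $s\not\models A$. A signed formula is valid in a frame if it is satisfied at every point of every model based on the frame. Composition: $s(R\circ S)t$ iff there is $u$ with $sRu$ and $uSt$. Quantifiers in the conditions range over $W$. A signed formula $(\beta,B)$ is a positive definition of a class $\mathcal{C}$ of frames with respect to a class $\mathcal{D}$ of frames if for every frame in $\mathcal{D}$, $(\beta,B)$ is valid in the frame iff the frame is in $\mathcal{C}$. -}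

module Defs where

open import Level using (Level; _⊔_) renaming (suc to lsuc)
open import Data.Empty.Polymorphic as Empty using ()
open import Data.Nat.Base using (ℕ)
open import Data.Product.Base using (∃-syntax; _×_; _,_)
open import Data.Sign.Base using (Sign; +; -)
open import Data.Sum.Base using (_⊎_)
open import Data.Unit.Polymorphic as Unit using ()
open import Data.Vec.Base using (Vec; []; _∷_)
open import Function.Base using (flip)
open import Function.Bundles using (_⇔_)
open import Relation.Binary.Construct.Composition using () renaming (_;_ to _∘_)
open import Relation.Binary.Core using (Rel)
open import Relation.Binary.Definitions using (_Respects_)
open import Relation.Binary.PropositionalEquality.Core using (_≡_)
open import Relation.Binary.Structures using (IsPreorder)
open import Relation.Nullary.Negation.Core using (¬_)
open import Relation.Unary using (Pred; _∈_; _∉_)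

-- The atom pᵢ is represented by its index i.
At : Set
At = ℕ

infixr 5 _⇀_ _↽_
infixr 6 _∨_
infixr 7 _∧_
infix 8 ◇_ □_ ⧫_ ■_

data Formula : Set where
  atom            : At → Formula
  _⇀_ _↽_ _∨_ _∧_ : Formula → Formula → Formula
  ⊤ ⊥             : Formula
  ◇_ □_ ⧫_ ■_     : Formula → Formula

SignedFormula : Set
SignedFormula = Sign × Formula

record Frame (ℓ : Level) : Set (lsuc ℓ) where
  infix 4 _≤_ _≥_
  field
    W          : Set ℓ
    nonempty   : W
    _≤_        : Rel W ℓ
    isPreorder : IsPreorder _≡_ _≤_
    R          : Rel W ℓ

  _≥_ : Rel W ℓ
  _≥_ = flip _≤_

record Model {ℓ : Level} (F : Frame ℓ) : Set (lsuc ℓ) where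
  open Frame F
  field
    V      : At → Pred W ℓ
    closed : ∀ p → V p Respects _≤_

module _ {ℓ : Level} {F : Frame ℓ} (M : Model F) where
  open Frame F
  open Model M

  infix 4 _⊨_ _⊨±_

  _⊨_ : W → Formula → Set ℓ
  s ⊨ atom p  = s ∈ V p
  s ⊨ (A ⇀ B) = ∀ t → t ≥ s → ¬ (t ⊨ A) ⊎ (t ⊨ B)
  s ⊨ (A ↽ B) = ∃[ t ] t ≤ s × ¬ (t ⊨ A) × (t ⊨ B)
  s ⊨ (A ∨ B) = (s ⊨ A) ⊎ (s ⊨ B)
  s ⊨ (A ∧ B) = (s ⊨ A) × (s ⊨ B)
  s ⊨ ⊤       = Unit.⊤
  s ⊨ ⊥       = Empty.⊥
  s ⊨ (◇ A)   = ∃[ t ] ∃[ u ] t ≤ s × R t u × (u ⊨ A)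
  s ⊨ (□ A)   = ∀ t → t ≥ s → ∀ u → R t u → u ⊨ A
  s ⊨ (⧫ A)   = ∀ t → t ≥ s → ∃[ u ] R t u × (u ⊨ A)
  s ⊨ (■ A)   = ∃[ t ] t ≤ s × (∀ u → R t u → u ⊨ A)

  _⊨±_ : W → SignedFormula → Set ℓ
  s ⊨± (+ , A) = s ⊨ A
  s ⊨± (- , A) = ¬ (s ⊨ A)

Valid : ∀ {ℓ} → Frame ℓ → SignedFormula → Set (lsuc ℓ)
Valid F φ = (M : Model F) (s : Frame.W F) → _⊨±_ M s φ

PositiveDefinition : ∀ {ℓ c d} → SignedFormula →
                     Pred (Frame ℓ) c → Pred (Frame ℓ) d → Set (lsuc ℓ ⊔ c ⊔ d)
PositiveDefinition φ 𝒞 𝒟 = ∀ F → F ∈ 𝒟 → Valid F φ ⇔ F ∈ 𝒞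

correspondences : ∀ {ℓ} → At → Vec (Pred (Frame ℓ) ℓ × SignedFormula) 14
correspondences a =
  let p = atom a in
    ( (λ F → let open Frame F in
         ∀ s → ∃[ t ] (_≥_ ∘ R) s t)
    , (+ , ◇ ⊤) )
  ∷ ( (λ F → let open Frame F in
         ∀ s → ∃[ t ] (_≤_ ∘ R) s t)
    , (- , □ ⊥) )
  ∷ ( (λ F → let open Frame F in
         ∀ s → (_≥_ ∘ R ∘ _≥_) s s)
    , (+ , p ⇀ ◇ p) )
  ∷ ( (λ F → let open Frame F in
         ∀ s → (_≤_ ∘ R ∘ _≤_) s s)
    , (- , p ↽ □ p) )
  ∷ ( (λ F → let open Frame F in
         ∀ s → (R ∘ _≥_) s s)
    , (+ , p ⇀ ⧫ p) )
  ∷ ( (λ F → let open Frame F in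
         ∀ s → (R ∘ _≤_) s s)
    , (- , p ↽ ■ p) )
  ∷ ( (λ F → let open Frame F in
         ∀ s t → R s t → (_≥_ ∘ R ∘ _≥_) t s)
    , (+ , p ⇀ □ ◇ p) )
  ∷ ( (λ F → let open Frame F in
         ∀ s t → R s t → (_≤_ ∘ R ∘ _≤_) t s)
    , (- , p ↽ ◇ □ p) )
  ∷ ( (λ F → let open Frame F in
         ∀ s t → (R ∘ _≤_) s t → (R ∘ _≥_) t s)
    , (+ , p ⇀ □ ⧫ p) )
  ∷ ( (λ F → let open Frame F in
         ∀ s t → (R ∘ _≥_) s t → (R ∘ _≤_) t s)
    , (- , p ↽ ◇ ■ p) )
  ∷ ( (λ F → let open Frame F in
         ∀ s → ∃[ t ] t ≤ s × (∀ u → R t u → (_≥_ ∘ R ∘ _≥_) u s))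
    , (+ , p ⇀ ■ ◇ p) )
  ∷ ( (λ F → let open Frame F in
         ∀ s → ∃[ t ] t ≥ s × (∀ u → R t u → (_≤_ ∘ R ∘ _≤_) u s))
    , (- , p ↽ ⧫ □ p) )
  ∷ ( (λ F → let open Frame F in
         ∀ s → ∃[ t ] t ≤ s × (∀ u → (R ∘ _≤_) t u → (R ∘ _≥_) u s))
    , (+ , p ⇀ ■ ⧫ p) )
  ∷ ( (λ F → let open Frame F in
         ∀ s → ∃[ t ] t ≥ s × (∀ u → (R ∘ _≥_) t u → (R ∘ _≤_) u s))
    , (- , p ↽ ⧫ ■ p) )
  ∷ []

{-# OPTIONS --safe #-}
-- Reversing ≤ and complementing the valuation exchanges a formula with the negation of its dual
-- (⇀ with ↽, ◇ with □, ⧫ with ■), so each negative item is the preceding positive item read in the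
-- reversed frame. For p ⇀ A with A positive in p, the smallest valuation making p true at s is
-- the up-set of s; hence validity only has to be tested for A at s under that valuation, where it
-- unfolds to the stated first-order condition (up to reflexivity and transitivity of ≤).
module Submission where

open import Defs
open import Axiom.ExcludedMiddle using (ExcludedMiddle)
open import Data.Fin using (Fin; #_)
open import Data.Product.Base using (_,_; proj₁; proj₂)
open import Data.Sign.Base using (+; -)
open import Data.Sum.Base using (inj₁; inj₂; [_,_]′)
open import Data.Unit.Polymorphic using (tt)
open import Data.Vec.Base using (lookup)
open import Data.Vec.Relation.Unary.All using (All; []; _∷_)
open import Data.Vec.Relation.Unary.All.Properties using (lookup⁺)
open import Function.Base using (flip; id)
open import Function.Bundles using (_⇔_; mk⇔; Equivalence)
import Function.Properties.Equivalence as ⇔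
open import Level using (Level)
open import Relation.Binary.Construct.Composition using () renaming (_;_ to _∘_)
open import Relation.Binary.Construct.Flip.EqAndOrd using () renaming (isPreorder to flip-isPreorder)
open import Relation.Binary.Structures using (IsPreorder)
open import Relation.Nullary.Decidable.Core using (yes; no; decidable-stable; toSum)
open import Relation.Nullary.Negation.Core using (¬_; contradiction)
open import Relation.Unary using (Pred; U; _∈_; _⊆_)

private
  variable
    ℓ c : Level

-- Atoms stay fixed because their negation is absorbed by complementing the valuation.
dual : Formula → Formula
dual (atom q) = atom q
dual (A ⇀ B)  = dual A ↽ dual B
dual (A ↽ B)  = dual A ⇀ dual B
dual (A ∨ B)  = dual A ∧ dual B
dual (A ∧ B)  = dual A ∨ dual B
dual ⊤        = ⊥
dual ⊥        = ⊤
dual (◇ A)    = □ dual A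
dual (□ A)    = ◇ dual A
dual (⧫ A)    = ■ dual A
dual (■ A)    = ⧫ dual A

reverse : Frame ℓ → Frame ℓ
reverse F = record
  { W          = W
  ; nonempty   = nonempty
  ; _≤_        = _≥_
  ; isPreorder = flip-isPreorder isPreorder
  ; R          = R
  }
  where open Frame F

module _ (em : ExcludedMiddle ℓ) {F : Frame ℓ} where
  open Frame F

  private
    dne : {P : Set ℓ} → ¬ ¬ P → P
    dne = decidable-stable em

  Complementary : Model F → Model (reverse F) → Set ℓ
  Complementary M N = ∀ q s → s ∈ Model.V N q ⇔ (¬ s ∈ Model.V M q)

  module _ {M : Model F} {N : Model (reverse F)} (M⊥N : Complementary M N) where

    -- Both directions go by simultaneous induction, since the antecedent of `⇀` and of `↽` calls
    -- for the opposite direction. Classical reasoning enters in `dual-satisfied`, for instance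
    -- where a refuted universal has to yield a witness.
    dual-refuted : ∀ A {s} → (N ⊨ s) A → ¬ (M ⊨ s) (dual A)
    dual-satisfied : ∀ A {s} → ¬ (M ⊨ s) (dual A) → (N ⊨ s) A

    dual-refuted (atom q) = Equivalence.to (M⊥N q _)
    dual-refuted (A ⇀ B) h (t , t≤s , ¬a , b) =
      [ (λ ¬A → ¬A (dual-satisfied A ¬a)) , (λ B⁺ → dual-refuted B B⁺ b) ]′ (h t t≤s)
    dual-refuted (A ↽ B) (t , s≤t , ¬A , B⁺) h =
      [ (λ ¬a → ¬A (dual-satisfied A ¬a)) , dual-refuted B B⁺ ]′ (h t s≤t)
    dual-refuted (A ∨ B) h (a , b) = [ flip (dual-refuted A) a , flip (dual-refuted B) b ]′ h
    dual-refuted (A ∧ B) (A⁺ , B⁺) = [ dual-refuted A A⁺ , dual-refuted B B⁺ ]′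
    dual-refuted ⊤ _ ()
    dual-refuted ⊥ ()
    dual-refuted (◇ A) (t , u , s≤t , tRu , A⁺) h = dual-refuted A A⁺ (h t s≤t u tRu)
    dual-refuted (□ A) h (t , u , t≤s , tRu , a) = dual-refuted A (h t t≤s u tRu) a
    dual-refuted (⧫ A) h (t , t≤s , a) =
      let (u , tRu , A⁺) = h t t≤s in dual-refuted A A⁺ (a u tRu)
    dual-refuted (■ A) (t , s≤t , A⁺) h =
      let (u , tRu , a) = h t s≤t in dual-refuted A (A⁺ u tRu) a

    dual-satisfied (atom q) = Equivalence.from (M⊥N q _)
    dual-satisfied (A ⇀ B) h t t≤s with em {(M ⊨ t) (dual A)}
    ... | yes a = inj₁ λ A⁺ → dual-refuted A A⁺ a
    ... | no ¬a = inj₂ (dual-satisfied B λ b → h (t , t≤s , ¬a , b))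
    dual-satisfied (A ↽ B) h = dne λ ¬A↽B → h λ t s≤t → [ inj₂ , (λ ¬b → inj₁ λ a →
      ¬A↽B (t , s≤t , flip (dual-refuted A) a , dual-satisfied B ¬b)) ]′ (toSum em)
    dual-satisfied (A ∨ B) h with em {(M ⊨ _) (dual A)}
    ... | yes a = inj₂ (dual-satisfied B λ b → h (a , b))
    ... | no ¬a = inj₁ (dual-satisfied A ¬a)
    dual-satisfied (A ∧ B) h =
      dual-satisfied A (λ a → h (inj₁ a)) , dual-satisfied B (λ b → h (inj₂ b))
    dual-satisfied ⊤ _ = tt
    dual-satisfied ⊥ h = contradiction tt h
    dual-satisfied (◇ A) h = dne λ ¬◇ → h λ t s≤t u tRu → dne λ ¬a →
      ¬◇ (t , u , s≤t , tRu , dual-satisfied A ¬a)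
    dual-satisfied (□ A) h t t≤s u tRu = dual-satisfied A λ a → h (t , u , t≤s , tRu , a)
    dual-satisfied (⧫ A) h t t≤s = dne λ ¬∃ → h (t , t≤s , λ u tRu → dne λ ¬a →
      ¬∃ (u , tRu , dual-satisfied A ¬a))
    dual-satisfied (■ A) h = dne λ ¬■ → h λ t s≤t → dne λ ¬∃ →
      ¬■ (t , s≤t , λ u tRu → dual-satisfied A λ a → ¬∃ (u , tRu , a))

  -- The complement of an up-closed set is down-closed, hence up-closed for the reversed order; so
  -- every model on either frame has a complementary model on the other.
  reverse-valid : ∀ A → Valid F (- , dual A) ⇔ Valid (reverse F) (+ , A)
  reverse-valid A = mk⇔
    -- The model on `F` is built from `N`, so `N` is its complement only up to double negation.
    (λ valid N s → dual-satisfied (λ _ _ → mk⇔ (λ x ¬x → ¬x x) dne) A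
      (valid (record
        { V      = λ q x → ¬ x ∈ Model.V N q
        ; closed = λ q x≤y ¬x y → ¬x (Model.closed N q x≤y y)
        }) s))
    (λ valid M s → dual-refuted {M = M} (λ _ _ → ⇔.refl) A
      (valid (record
        { V      = λ q x → ¬ x ∈ Model.V M q
        ; closed = λ q y≤x ¬x y → ¬x (Model.closed M q y≤x y)
        }) s))

reverse-positiveDefinition :
  ExcludedMiddle ℓ → ∀ A {𝒞 : Pred (Frame ℓ) c} → PositiveDefinition (+ , A) 𝒞 U →
  PositiveDefinition (- , dual A) (λ F → reverse F ∈ 𝒞) U
reverse-positiveDefinition em A def F _ = ⇔.trans (reverse-valid em A) (def (reverse F) _)

-- Modalities applied to `p`: the shape of every consequent of `⇀` in the list.
data PositiveIn (p : At) : Formula → Set where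
  atom : PositiveIn p (atom p)
  ◇_   : ∀ {A} → PositiveIn p A → PositiveIn p (◇ A)
  □_   : ∀ {A} → PositiveIn p A → PositiveIn p (□ A)
  ⧫_   : ∀ {A} → PositiveIn p A → PositiveIn p (⧫ A)
  ■_   : ∀ {A} → PositiveIn p A → PositiveIn p (■ A)

module _ {F : Frame ℓ} {p : At} (M N : Model F) (V⊆ : Model.V M p ⊆ Model.V N p) where

  ⊨-mono : ∀ {A} → PositiveIn p A → ∀ {s} → (M ⊨ s) A → (N ⊨ s) A
  ⊨-mono atom  = V⊆
  ⊨-mono (◇ A) (t , u , t≤s , tRu , a) = t , u , t≤s , tRu , ⊨-mono A a
  ⊨-mono (□ A) h t s≤t u tRu           = ⊨-mono A (h t s≤t u tRu)
  ⊨-mono (⧫ A) h t s≤t                 = let (u , tRu , a) = h t s≤t in u , tRu , ⊨-mono A a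
  ⊨-mono (■ A) (t , t≤s , h)           = t , t≤s , λ u tRu → ⊨-mono A (h u tRu)

module _ (F : Frame ℓ) where
  open Frame F
  open IsPreorder isPreorder using (refl; trans)

  upset : W → Model F
  upset s = record { V = λ _ t → s ≤ t ; closed = λ _ t≤u s≤t → trans s≤t t≤u }

  valid-⇀ : ExcludedMiddle ℓ → ∀ {p A} → PositiveIn p A →
            Valid F (+ , atom p ⇀ A) ⇔ (∀ s → (upset s ⊨ s) A)
  valid-⇀ em pos = mk⇔
    (λ valid s → [ contradiction refl , id ]′ (valid (upset s) s s refl))
    (λ h M s t _ →
      -- If `p` holds at `t`, closure puts the up-set of `t` inside the valuation of `p`, and
      -- monotonicity carries `A` over. Excluded middle decides `p` at `t`, as `⇀` is a disjunction
      -- at each point.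
      [ (λ t∈V → inj₂ (⊨-mono (upset t) M (λ t≤u → Model.closed M _ t≤u t∈V) pos (h t)))
      , inj₁ ]′ (toSum em))

  ◇-upset⇒ : ∀ p {s t} → (upset s ⊨ t) (◇ atom p) → (_≥_ ∘ R ∘ _≥_) t s
  ◇-upset⇒ _ (u , v , u≤t , uRv , s≤v) = u , u≤t , v , uRv , s≤v

  ◇-upset⇐ : ∀ p {s t} → (_≥_ ∘ R ∘ _≥_) t s → (upset s ⊨ t) (◇ atom p)
  ◇-upset⇐ _ (u , u≤t , v , uRv , s≤v) = u , v , u≤t , uRv , s≤v

module _ {ℓ} (em : ExcludedMiddle ℓ) (p : At) where

  ⇀-positiveDefinition : ∀ (𝒞 : Pred (Frame ℓ) ℓ) {A} → PositiveIn p A →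
    (∀ F → (∀ s → (upset F s ⊨ s) A) ⇔ F ∈ 𝒞) → PositiveDefinition (+ , atom p ⇀ A) 𝒞 U
  ⇀-positiveDefinition _ pos unfold F _ = ⇔.trans (valid-⇀ F em pos) (unfold F)

  -- The index k : Fin 14 stands for item k + 1 of the paper.
  condition : Fin 14 → Pred (Frame ℓ) ℓ
  condition k = proj₁ (lookup (correspondences p) k)

  Defines : Fin 14 → Set _
  Defines k = PositiveDefinition (proj₂ (lookup (correspondences {ℓ} p) k)) (condition k) U

  defines : All (λ (condition , φ) → PositiveDefinition φ condition U) (correspondences {ℓ} p)
  -- Each negative entry matches by computation: `dual` evaluates to its formula, and reversing the
  -- frame swaps `_≤_` and `_≥_` in the condition.
  defines = def₁  ∷ reverse-positiveDefinition em (◇ ⊤) def₁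
          ∷ def₃  ∷ reverse-positiveDefinition em (a ⇀ ◇ a) def₃
          ∷ def₅  ∷ reverse-positiveDefinition em (a ⇀ ⧫ a) def₅
          ∷ def₇  ∷ reverse-positiveDefinition em (a ⇀ □ ◇ a) def₇
          ∷ def₉  ∷ reverse-positiveDefinition em (a ⇀ □ ⧫ a) def₉
          ∷ def₁₁ ∷ reverse-positiveDefinition em (a ⇀ ■ ◇ a) def₁₁
          ∷ def₁₃ ∷ reverse-positiveDefinition em (a ⇀ ■ ⧫ a) def₁₃
          ∷ []
    where
    a : Formula
    a = atom p

    def₁ : Defines (# 0)
    def₁ F _ = mk⇔
      -- The truth of `◇ ⊤` does not depend on the valuation, so any model will do.
      (λ { valid s → let (t , u , t≤s , tRu , _) = valid (upset F s) s in u , t , t≤s , tRu })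
      (λ { h _ s → let (u , t , t≤s , tRu) = h s in t , u , t≤s , tRu , tt })

    def₃ : Defines (# 2)
    def₃ = ⇀-positiveDefinition (condition (# 2)) (◇ atom) λ F → mk⇔
      (λ h s → ◇-upset⇒ F p (h s))
      (λ h s → ◇-upset⇐ F p (h s))

    def₅ : Defines (# 4)
    def₅ = ⇀-positiveDefinition (condition (# 4)) (⧫ atom) λ F →
      let open IsPreorder (Frame.isPreorder F) in mk⇔
      (λ { h s → h s s refl })
      -- The condition is used at `t`; its witness lies above `t`, hence above `s`.
      (λ { h s t s≤t → let (u , tRu , t≤u) = h t in u , tRu , trans s≤t t≤u })

    def₇ : Defines (# 6)
    def₇ = ⇀-positiveDefinition (condition (# 6)) (□ ◇ atom) λ F →
      let open IsPreorder (Frame.isPreorder F) in mk⇔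
      (λ { h s t sRt → ◇-upset⇒ F p (h s s refl t sRt) })
      (λ { h s t s≤t u tRu →
        let (v , v≤u , w , vRw , t≤w) = h t u tRu in v , w , v≤u , vRw , trans s≤t t≤w })

    def₉ : Defines (# 8)
    def₉ = ⇀-positiveDefinition (condition (# 8)) (□ ⧫ atom) λ F →
      let open IsPreorder (Frame.isPreorder F) in mk⇔
      -- The premise composes the `R`-step of `□` with the upward step of `⧫`.
      (λ { h s t (u , sRu , u≤t) → h s s refl u sRu t u≤t })
      (λ { h s t s≤t u tRu v u≤v →
        let (w , vRw , t≤w) = h t v (u , tRu , u≤v) in w , vRw , trans s≤t t≤w })

    def₁₁ : Defines (# 10)
    def₁₁ = ⇀-positiveDefinition (condition (# 10)) (■ ◇ atom) λ F → mk⇔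
      -- `■` and the condition both open with a point below `s`, so the same `t` serves in both
      -- directions.
      (λ { h s → let (t , t≤s , k) = h s in t , t≤s , λ u tRu → ◇-upset⇒ F p (k u tRu) })
      (λ { h s → let (t , t≤s , k) = h s in t , t≤s , λ u tRu → ◇-upset⇐ F p (k u tRu) })

    def₁₃ : Defines (# 12)
    def₁₃ = ⇀-positiveDefinition (condition (# 12)) (■ ⧫ atom) λ F → mk⇔
      (λ { h s → let (t , t≤s , k) = h s in t , t≤s , λ { u (v , tRv , v≤u) → k v tRv u v≤u } })
      (λ { h s → let (t , t≤s , k) = h s in t , t≤s , λ v tRv u v≤u → k u (v , tRv , v≤u) })

proposition22 : ∀ {ℓ} → ExcludedMiddle ℓ → (p : At) (k : Fin 14) →
    let (condition , φ) = lookup (correspondences {ℓ} p) k in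
    PositiveDefinition φ condition U
proposition22 em p k = lookup⁺ (defines em p) k
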